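{- A word of length $n$ over an alphabet of size $\sigma$ can have $\Omega(n\sigma/\log_{\sigma}n)$ minimal absent words all of the same length. That is, there are an absolute constant $c>0$ and an integer $n_0$ such that for all integers $n\ge n_0$ and $2\le\sigma\le n$ there exist an alphabet $\Sigma$ of size $\sigma$, a word $w$ of length $n$ over $\Sigma$, and an integer $m$ such that $w$ has at least $c\,n\sigma/\log_{\sigma}n$ minimal absent words of length $m$.
   Context: A factor of a word is a contiguous subword. For a word $w$ over an alphabet $\Sigma$, a word $aub$ with $a,b\in\Sigma$ and $u$ a (possibly empty) word over $\Sigma$ is a minimal absent word of $w$ if $aub$ is not a factor of $w$ but both $au$ and $ub$ are factors of $w$. -}

module Defs where

open import Data.Integer.Base using (+_; ∣_∣)
open import Data.List.Base using (List; []; _∷_; _++_; [_])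
open import Data.List.Relation.Binary.Infix.Heterogeneous using (Infix)
open import Data.Nat.Base as ℕ using (ℕ)
open import Data.Product.Base using (_×_; ∃-syntax)
open import Data.Rational.Unnormalised.Base
  using (ℚᵘ; _≤_; _/_; _÷_; Positive; ↥_; ↧ₙ_)
open import Data.Rational.Unnormalised.Properties using (pos⇒nonZero)
open import Relation.Binary.PropositionalEquality.Core using (_≡_)
open import Relation.Nullary.Negation.Core using (¬_)

_isFactorOf_ : {A : Set} → List A → List A → Set
_isFactorOf_ = Infix _≡_

IsMinimalAbsentWord : {A : Set} → List A → List A → Set
IsMinimalAbsentWord w v =
  ∃[ a ] ∃[ u ] ∃[ b ]
    (v ≡ a ∷ u ++ [ b ])
    × ¬ (v isFactorOf w)
    × ((a ∷ u) isFactorOf w)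
    × ((u ++ [ b ]) isFactorOf w)

fromℕ : ℕ → ℚᵘ
fromℕ k = + k / 1

-- The real number log_b n (for b ≥ 2 and n ≥ 1) is given by its upper Dedekind
-- cut. For positive q = s / t, log_b n < s / t means n ^ t < b ^ s. Numerator
-- and denominator need not be coprime: the condition depends only on s / t.
log[_]_<_ : ℕ → ℕ → (q : ℚᵘ) → .{{Positive q}} → Set
log[ b ] n < q = n ℕ.^ (↧ₙ q) ℕ.< b ℕ.^ ∣ ↥ q ∣

-- The real inequality x / log_b n ≤ y, for x ≥ 0, b ≥ 2 and n ≥ 2: the real
-- number x / log_b n is the supremum of x / q over the rationals q > log_b n.
_/log[_]_≤_ : ℚᵘ → ℕ → ℕ → ℚᵘ → Set
x /log[ b ] n ≤ y =
  (q : ℚᵘ) .{{_ : Positive q}} → log[ b ] n < q → (x ÷ q) {{pos⇒nonZero q}} ≤ y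

{-# OPTIONS --safe #-}
-- Fix two letters 0 and 1. For x = x₁…x_k put u(x) = 110 x₁0 x₂0 … x_k0 and
-- concatenate the blocks 0 a u(x) a, for s letters a and M words x, padding
-- with 0s. As 110 occurs only at the start of each u(x), the word a u(x) b
-- occurs only if a = b; but a u(x) and u(x) b always occur. So the M s (s − 1)
-- words a u(x) b with a ≠ b are minimal absent words of length 2k + 5.
-- Taking σ^k ≤ n < σ^(k+1) and blocks that fill a constant fraction of the
-- word makes this number of order nσ / k.

module Submission where

open import Defs
open import Data.Empty using (⊥-elim)
open import Data.Fin.Base using (Fin; zero; suc; finToFun; funToFin; inject≤; punchIn)
open import Data.Fin.Properties
  using (funToFin-finToFin; inject≤-injective; punchIn-injective; punchInᵢ≢i)
open import Data.Integer.Base as ℤ using (+_; +[1+_]; -[1+_]; +≤+)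
import Data.Integer.Properties as ℤ
open import Data.List.Base
  using (List; []; _∷_; [_]; _++_; length; map; replicate; allFin; cartesianProduct)
open import Data.List.Membership.Propositional using (_∈_)
open import Data.List.Membership.Propositional.Properties
  using (∈-map⁺; ∈-cartesianProduct⁺; ∈-allFin)
open import Data.List.Properties
  using (∷-injective; length-++; length-map; length-replicate; length-tabulate)
open import Data.List.Relation.Binary.Infix.Heterogeneous using (here; there; _++ⁱ_)
open import Data.List.Relation.Binary.Prefix.Heterogeneous using (Prefix; []; _∷_)
open import Data.List.Relation.Unary.All using (All; universal)
import Data.List.Relation.Unary.All.Properties as All
open import Data.List.Relation.Unary.Any using (here; there)
open import Data.List.Relation.Unary.Unique.Propositional using (Unique)
import Data.List.Relation.Unary.Unique.Propositional.Properties as Unique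
open import Data.Nat.Base using (ℕ; zero; suc; z≤n; s≤s; _≤_; _<_; _∸_; _^_; _/_; NonZero)
import Data.Nat.Base as ℕ
open import Data.Nat.DivMod using (m/n*n≤m; m≡m%n+[m/n]*n; m%n<n)
open import Data.Nat.Properties
open import Data.Nat.Tactic.RingSolver using (solve-∀)
open import Data.Product.Base using (_×_; _,_; proj₁; proj₂; ∃-syntax; Σ-syntax)
open import Data.Rational.Unnormalised.Base using (ℚᵘ; mkℚᵘ; Positive; _*_; *≤*)
open import Data.Vec.Base using (Vec; []; _∷_; lookup; tabulate)
open import Data.Vec.Properties using (lookup∘tabulate)
open import Function.Base using (_∘_)
open import Relation.Binary.PropositionalEquality
  using (_≡_; _≢_; refl; sym; trans; cong; cong₂; subst; module ≡-Reasoning)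
open import Relation.Nullary using (¬_; yes; no)

-- Lengths of the index lists

length-cartesianProduct : {A B : Set} (xs : List A) (ys : List B) →
  length (cartesianProduct xs ys) ≡ length xs ℕ.* length ys
length-cartesianProduct []       ys = refl
length-cartesianProduct (x ∷ xs) ys = begin
  length (map (x ,_) ys ++ cartesianProduct xs ys)
    ≡⟨ length-++ (map (x ,_) ys) ⟩
  length (map (x ,_) ys) ℕ.+ length (cartesianProduct xs ys)
    ≡⟨ cong₂ ℕ._+_ (length-map (x ,_) ys) (length-cartesianProduct xs ys) ⟩
  length ys ℕ.+ length xs ℕ.* length ys ∎
  where open ≡-Reasoning

length-allFin : ∀ n → length (allFin n) ≡ n
length-allFin n = length-tabulate (λ i → i)

-- The block word and its minimal absent words

module Blocks {A : Set} (𝟎 𝟏 : A) (𝟎≢𝟏 : 𝟎 ≢ 𝟏) where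

  spread : ∀ {k} → Vec A k → List A
  spread []      = []
  spread (y ∷ x) = y ∷ 𝟎 ∷ spread x

  -- The third letter of the marker fixes the alignment: a block with letter 𝟏 starts 𝟎𝟏𝟏𝟏𝟎, where
  -- 𝟏𝟏 occurs twice but 𝟏𝟏𝟎 only once.
  core : ∀ {k} → Vec A k → List A
  core x = 𝟏 ∷ 𝟏 ∷ 𝟎 ∷ spread x

  -- The 𝟎 that opens a block keeps the closing letter of the previous block from being followed by
  -- a 𝟏. The final `r` letters only adjust the length.
  word : ∀ {k} → List (A × Vec A k) → ℕ → List A
  word []             r = replicate r 𝟎
  word ((a , x) ∷ bs) r = 𝟎 ∷ a ∷ core x ++ a ∷ word bs r

  length-spread : ∀ {k} (x : Vec A k) l → length (spread x ++ l) ≡ 2 ℕ.* k ℕ.+ length l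
  length-spread []            l = refl
  length-spread {suc k} (y ∷ x) l
    rewrite length-spread x l = p k (length l)
    where
    p : ∀ k m → suc (suc (2 ℕ.* k ℕ.+ m)) ≡ 2 ℕ.* suc k ℕ.+ m
    p = solve-∀

  length-word : ∀ {k} (bs : List (A × Vec A k)) r →
    length (word bs r) ≡ length bs ℕ.* (6 ℕ.+ 2 ℕ.* k) ℕ.+ r
  length-word []                 r = length-replicate r
  length-word {k} ((a , x) ∷ bs) r
    rewrite length-spread x (a ∷ word bs r) | length-word bs r =
    p k (length bs ℕ.* (6 ℕ.+ 2 ℕ.* k)) r
    where
    p : ∀ k m r → 5 ℕ.+ (2 ℕ.* k ℕ.+ suc (m ℕ.+ r)) ≡ 6 ℕ.+ 2 ℕ.* k ℕ.+ m ℕ.+ r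
    p = solve-∀

  spread-injective : ∀ {k} (x x′ : Vec A k) {b b′} →
    spread x ++ [ b ] ≡ spread x′ ++ [ b′ ] → x ≡ x′ × b ≡ b′
  spread-injective []      []        refl = refl , refl
  spread-injective (y ∷ x) (y′ ∷ x′) eq with ∷-injective eq
  ... | refl , eq′ with spread-injective x x′ (proj₂ (∷-injective eq′))
  ...   | refl , b≡b′ = refl , b≡b′

  -- Both spreads have length 2k, so `b` and `b′` stand at the same position.
  spread-prefix : ∀ {k} (x x′ : Vec A k) {b b′ l} →
    Prefix _≡_ (spread x ++ [ b ]) (spread x′ ++ b′ ∷ l) → b ≡ b′
  spread-prefix []      []        (b≡b′ ∷ _)  = b≡b′
  spread-prefix (y ∷ x) (y′ ∷ x′) (_ ∷ _ ∷ p) = spread-prefix x x′ p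

  word-starts-with-𝟎 : ∀ {k} (bs : List (A × Vec A k)) {r q} → ¬ Prefix _≡_ (𝟏 ∷ q) (word bs r)
  word-starts-with-𝟎 []      {suc r} (1≡0 ∷ _) = 𝟎≢𝟏 (sym 1≡0)
  word-starts-with-𝟎 (_ ∷ _)         (1≡0 ∷ _) = 𝟎≢𝟏 (sym 1≡0)

  padding-free : ∀ {a q} r → ¬ (a ∷ 𝟏 ∷ q) isFactorOf replicate r 𝟎
  padding-free (suc (suc r)) (here (_ ∷ 1≡0 ∷ _)) = 𝟎≢𝟏 (sym 1≡0)
  padding-free (suc r)       (there i)            = padding-free r i
  padding-free (suc zero)    (here (_ ∷ ()))
  padding-free zero          (here ())

  -- Every other letter of `𝟎 ∷ spread x` is 𝟎, and `a′` is followed by 𝟎 or by nothing, so no match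
  -- of `a ∷ 𝟏 ∷ 𝟏 ∷ q` can start before `word bs r`. The list keeps the last 𝟎 of the marker in
  -- front so that dropping two letters restores its shape.
  skip-spread : ∀ {k k′} (x : Vec A k′) (bs : List (A × Vec A k)) {r a a′ q} →
    (a ∷ 𝟏 ∷ 𝟏 ∷ q) isFactorOf (𝟎 ∷ spread x ++ a′ ∷ word bs r) →
    (a ∷ 𝟏 ∷ 𝟏 ∷ q) isFactorOf word bs r
  skip-spread []      bs (here (_ ∷ _ ∷ p))         = ⊥-elim (word-starts-with-𝟎 bs p)
  skip-spread []      bs (there (here (_ ∷ p)))     = ⊥-elim (word-starts-with-𝟎 bs p)
  skip-spread []      bs (there (there i))          = i
  skip-spread (y ∷ x) bs (here (_ ∷ _ ∷ 1≡0 ∷ _))   = ⊥-elim (𝟎≢𝟏 (sym 1≡0))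
  skip-spread (y ∷ x) bs (there (here (_ ∷ 1≡0 ∷ _))) = ⊥-elim (𝟎≢𝟏 (sym 1≡0))
  skip-spread (y ∷ x) bs (there (there i))          = skip-spread x bs i

  -- 110 occurs in the word only as the first three letters of a core, so the
  -- occurrence is aligned with a block.
  factor⇒same-ends : ∀ {k} (bs : List (A × Vec A k)) {r a b} (x : Vec A k) →
    (a ∷ core x ++ [ b ]) isFactorOf word bs r → a ≡ b
  factor⇒same-ends [] {r} x i = ⊥-elim (padding-free r i)
  factor⇒same-ends (_ ∷ bs) x (here (_ ∷ _ ∷ _ ∷ 0≡1 ∷ _)) = ⊥-elim (𝟎≢𝟏 0≡1)
  factor⇒same-ends ((_ , x′) ∷ bs) x (there (here (a≡a′ ∷ _ ∷ _ ∷ _ ∷ p))) =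
    trans a≡a′ (sym (spread-prefix x x′ p))
  factor⇒same-ends (_ ∷ bs) x (there (there (here (_ ∷ _ ∷ 1≡0 ∷ _)))) = ⊥-elim (𝟎≢𝟏 (sym 1≡0))
  factor⇒same-ends (_ ∷ bs) x (there (there (there (here (_ ∷ 1≡0 ∷ _))))) = ⊥-elim (𝟎≢𝟏 (sym 1≡0))
  factor⇒same-ends ((_ , x′) ∷ bs) x (there (there (there (there i)))) =
    factor⇒same-ends bs x (skip-spread x′ bs i)

  ++-prefix : ∀ (xs : List A) {ys zs} → Prefix _≡_ ys zs → Prefix _≡_ (xs ++ ys) (xs ++ zs)
  ++-prefix []       p = p
  ++-prefix (x ∷ xs) p = refl ∷ ++-prefix xs p

  block-factor : ∀ {k a} {x : Vec A k} {bs} r → (a , x) ∈ bs →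
    (a ∷ core x ++ [ a ]) isFactorOf word bs r
  block-factor {x = x} r (here refl) = there (here (++-prefix (_ ∷ core x) (refl ∷ [])))
  block-factor {bs = (a′ , x′) ∷ bs} r (there a,x∈bs) =
    there (there (core x′ ++ⁱ there (block-factor r a,x∈bs)))

  factor-init : ∀ (xs : List A) {ys w} → (xs ++ ys) isFactorOf w → xs isFactorOf w
  factor-init xs (there i) = there (factor-init xs i)
  factor-init xs (here p)  = here (prefix-init xs p)
    where
    prefix-init : ∀ (xs : List A) {ys w} → Prefix _≡_ (xs ++ ys) w → Prefix _≡_ xs w
    prefix-init []       p        = []
    prefix-init (x ∷ xs) (eq ∷ p) = eq ∷ prefix-init xs p

  factor-tail : ∀ {x : A} {xs w} → (x ∷ xs) isFactorOf w → xs isFactorOf w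
  factor-tail (here (_ ∷ p)) = there (here p)
  factor-tail (there i)      = there (factor-tail i)

  -- The two factors come from two blocks with the same core: the block of `(a , x)` gives the word
  -- without its last letter, that of `(b , x)` the word without its first.
  minimalAbsent : ∀ {k a b} {x : Vec A k} {bs} r → (a , x) ∈ bs → (b , x) ∈ bs → a ≢ b →
    IsMinimalAbsentWord (word bs r) (a ∷ core x ++ [ b ])
  minimalAbsent {a = a} {b} {x} {bs} r a∈ b∈ a≢b =
    a , core x , b , refl ,
    a≢b ∘ factor⇒same-ends bs x ,
    factor-init (a ∷ core x) (block-factor r a∈) ,
    factor-tail (block-factor r b∈)

  -- Counting the absent words

  module _ {t M k : ℕ}
    (letter : Fin (suc t) → A) (letter-injective : ∀ {i j} → letter i ≡ letter j → i ≡ j)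
    (code : Fin M → Vec A k) (code-injective : ∀ {i j} → code i ≡ code j → i ≡ j)
    where

    blocks : List (A × Vec A k)
    blocks = map (λ (j , i) → letter i , code j) (cartesianProduct (allFin M) (allFin (suc t)))

    length-blocks : length blocks ≡ M ℕ.* suc t
    length-blocks = begin
      length blocks ≡⟨ length-map _ (cartesianProduct (allFin M) (allFin (suc t))) ⟩
      length (cartesianProduct (allFin M) (allFin (suc t)))
        ≡⟨ length-cartesianProduct (allFin M) (allFin (suc t)) ⟩
      length (allFin M) ℕ.* length (allFin (suc t))
        ≡⟨ cong₂ ℕ._*_ (length-allFin M) (length-allFin (suc t)) ⟩
      M ℕ.* suc t ∎
      where open ≡-Reasoning

    ∈-blocks : ∀ i j → (letter i , code j) ∈ blocks
    ∈-blocks i j = ∈-map⁺ _ (∈-cartesianProduct⁺ (∈-allFin j) (∈-allFin i))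

    -- The last coordinate goes through `punchIn i`, which enumerates the letters other than `i`.
    -- Ordered pairs of distinct letters thus form a plain product of size `suc t * t`.
    indices : List (Fin M × Fin (suc t) × Fin t)
    indices = cartesianProduct (allFin M) (cartesianProduct (allFin (suc t)) (allFin t))

    absentWord : Fin M × Fin (suc t) × Fin t → List A
    absentWord (j , i , c) = letter i ∷ core (code j) ++ [ letter (punchIn i c) ]

    absentWord-injective : ∀ {p q} → absentWord p ≡ absentWord q → p ≡ q
    absentWord-injective {j , i , c} {j′ , i′ , c′} eq
      with letters , cores ← ∷-injective eq
      with refl ← letter-injective letters
      -- The nested `∷-injective` strip the marker 𝟏𝟏𝟎.
      with codes , ends ← spread-injective (code j) (code j′) (proj₂ (∷-injective (proj₂ (∷-injective (proj₂ (∷-injective cores))))))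
      with refl ← code-injective codes
      with refl ← punchIn-injective i c c′ (letter-injective ends) = refl

    absentWords : List (List A)
    absentWords = map absentWord indices

    absentWords-unique : Unique absentWords
    absentWords-unique = Unique.map⁺ absentWord-injective
      (Unique.cartesianProduct⁺ (Unique.allFin⁺ M)
        (Unique.cartesianProduct⁺ (Unique.allFin⁺ (suc t)) (Unique.allFin⁺ t)))

    length-absentWords : length absentWords ≡ M ℕ.* (suc t ℕ.* t)
    length-absentWords = begin
      length absentWords ≡⟨ length-map _ indices ⟩
      length indices ≡⟨ length-cartesianProduct (allFin M) _ ⟩
      length (allFin M) ℕ.* length (cartesianProduct (allFin (suc t)) (allFin t))
        ≡⟨ cong₂ ℕ._*_ (length-allFin M) (length-cartesianProduct (allFin (suc t)) (allFin t)) ⟩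
      M ℕ.* (length (allFin (suc t)) ℕ.* length (allFin t))
        ≡⟨ cong (M ℕ.*_) (cong₂ ℕ._*_ (length-allFin (suc t)) (length-allFin t)) ⟩
      M ℕ.* (suc t ℕ.* t) ∎
      where open ≡-Reasoning

    absentWords-minimal : ∀ r → All
      (λ v → IsMinimalAbsentWord (word blocks r) v × length v ≡ 4 ℕ.+ (2 ℕ.* k ℕ.+ 1)) absentWords
    absentWords-minimal r = All.map⁺ (universal (λ (j , i , c) →
      minimalAbsent r (∈-blocks i j) (∈-blocks (punchIn i c) j)
        (punchInᵢ≢i i c ∘ sym ∘ letter-injective) ,
      cong (4 ℕ.+_) (length-spread (code j) _)) indices)

-- Codes as base-σ digit vectors

digits : ∀ {σ k} → Fin (σ ^ k) → Vec (Fin σ) k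
digits {σ} {k} i = tabulate (finToFun {σ} {k} i)

-- Takes the place of function extensionality: equal digit vectors give digit functions that agree
-- only pointwise.
funToFin-cong : ∀ {m n} {f g : Fin m → Fin n} → (∀ i → f i ≡ g i) → funToFin f ≡ funToFin g
funToFin-cong {zero}  f≗g = refl
funToFin-cong {suc m} f≗g rewrite f≗g zero | funToFin-cong (f≗g ∘ suc) = refl

digits-injective : ∀ {σ k} {i j : Fin (σ ^ k)} → digits {σ} {k} i ≡ digits j → i ≡ j
digits-injective {σ} {k} {i} {j} eq = begin
  i ≡⟨ funToFin-finToFin {k} {σ} i ⟨
  funToFin (finToFun {σ} {k} i) ≡⟨ funToFin-cong same ⟩
  funToFin (finToFun {σ} {k} j) ≡⟨ funToFin-finToFin {k} {σ} j ⟩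
  j ∎
  where
  open ≡-Reasoning
  same : ∀ l → finToFun {σ} {k} i l ≡ finToFun {σ} {k} j l
  same l = trans (sym (lookup∘tabulate _ l)) (trans (cong (λ v → lookup v l) eq) (lookup∘tabulate _ l))

-- Integer logarithm and numerical estimates

⌊log⌋ : ∀ {σ} → 2 ≤ σ → ∀ n → 1 ≤ n → ∃[ k ] (σ ^ k ≤ n × n < σ ^ suc k)
⌊log⌋ {σ} 2≤σ 1 _ = 0 , ≤-refl , subst (1 <_) (sym (*-identityʳ σ)) 2≤σ
⌊log⌋ {σ} 2≤σ (suc n@(suc _)) _ with ⌊log⌋ 2≤σ n (s≤s z≤n)
... | k , lo , hi with σ ^ suc k ≤? suc n
-- `hi` unfolds to `suc n ≤ σ ^ suc k`, so the exponent grows by at most one at each step.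
...   | yes le = suc k , le , ≤-<-trans hi (^-monoʳ-< σ 2≤σ (n<1+n (suc k)))
...   | no  gt = k , m≤n⇒m≤1+n lo , ≰⇒> gt

n<[1+n/d]*d : ∀ n d .{{_ : NonZero d}} → n < suc (n / d) ℕ.* d
n<[1+n/d]*d n d = begin-strict
  n ≡⟨ m≡m%n+[m/n]*n n d ⟩
  n ℕ.% d ℕ.+ n / d ℕ.* d <⟨ +-monoˡ-< (n / d ℕ.* d) (m%n<n n d) ⟩
  d ℕ.+ n / d ℕ.* d ∎
  where open ≤-Reasoning

6+2[1+k]≤8[1+k] : ∀ k → 6 ℕ.+ 2 ℕ.* suc k ≤ 8 ℕ.* suc k
6+2[1+k]≤8[1+k] k = ≤-trans (m≤m+n _ (6 ℕ.* k)) (≤-reflexive (q k))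
  where
  q : ∀ k → 6 ℕ.+ 2 ℕ.* suc k ℕ.+ 6 ℕ.* k ≡ 8 ℕ.* suc k
  q = solve-∀

-- The left side is the length of a block whose code has length k + 1. In `one-code` this bounds the
-- length by a multiple of 2^k, which then cancels.
8+2k≤8*2^k : ∀ k → 8 ℕ.+ 2 ℕ.* k ≤ 8 ℕ.* 2 ^ k
8+2k≤8*2^k zero    = ≤-refl
8+2k≤8*2^k (suc k) = begin
  8 ℕ.+ 2 ℕ.* suc k ≤⟨ m≤m+n _ (6 ℕ.+ 2 ℕ.* k) ⟩
  8 ℕ.+ 2 ℕ.* suc k ℕ.+ (6 ℕ.+ 2 ℕ.* k) ≡⟨ q k ⟩
  2 ℕ.* (8 ℕ.+ 2 ℕ.* k) ≤⟨ *-monoʳ-≤ 2 (8+2k≤8*2^k k) ⟩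
  2 ℕ.* (8 ℕ.* 2 ^ k) ≡⟨ p (2 ^ k) ⟩
  8 ℕ.* 2 ^ suc k ∎
  where
  open ≤-Reasoning
  p : ∀ m → 2 ℕ.* (8 ℕ.* m) ≡ 8 ℕ.* (2 ℕ.* m)
  p = solve-∀
  q : ∀ k → 8 ℕ.+ 2 ℕ.* suc k ℕ.+ (6 ℕ.+ 2 ℕ.* k) ≡ 2 ℕ.* (8 ℕ.+ 2 ℕ.* k)
  q = solve-∀

-- This is `two-blocks-fit` for codes of length 5 + j, whose blocks have length 16 + 2j; at j = 0
-- both sides are 32.
2[16+2j]≤2^[5+j] : ∀ j → 2 ℕ.* (16 ℕ.+ 2 ℕ.* j) ≤ 2 ^ (5 ℕ.+ j)
2[16+2j]≤2^[5+j] zero    = ≤-refl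
2[16+2j]≤2^[5+j] (suc j) = *-monoʳ-≤ 2 (begin
  16 ℕ.+ 2 ℕ.* suc j ≤⟨ m≤m+n _ (14 ℕ.+ 2 ℕ.* j) ⟩
  16 ℕ.+ 2 ℕ.* suc j ℕ.+ (14 ℕ.+ 2 ℕ.* j) ≡⟨ q j ⟩
  2 ℕ.* (16 ℕ.+ 2 ℕ.* j) ≤⟨ 2[16+2j]≤2^[5+j] j ⟩
  2 ^ (5 ℕ.+ j) ∎)
  where
  open ≤-Reasoning
  q : ∀ j → 16 ℕ.+ 2 ℕ.* suc j ℕ.+ (14 ℕ.+ 2 ℕ.* j) ≡ 2 ℕ.* (16 ℕ.+ 2 ℕ.* j)
  q = solve-∀

-- Source of the threshold 32: two distinct block letters are needed for any absent word. For k ≤ 5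
-- two blocks have total length at most 32; for larger k the power of two dominates.
two-blocks-fit : ∀ {n} k → 32 ≤ n → 2 ^ k ≤ n → 2 ℕ.* (6 ℕ.+ 2 ℕ.* k) ≤ n
two-blocks-fit k 32≤n 2^k≤n with k ≤? 5
... | yes k≤5 = ≤-trans (*-monoʳ-≤ 2 (+-monoʳ-≤ 6 (*-monoʳ-≤ 2 k≤5))) 32≤n
... | no  k≰5 with j , refl ← m≤n⇒∃[o]m+o≡n (<⇒≤ (≰⇒> k≰5)) =
  ≤-trans (≤-reflexive (p j)) (≤-trans (2[16+2j]≤2^[5+j] j) 2^k≤n)
  where
  p : ∀ j → 2 ℕ.* (6 ℕ.+ 2 ℕ.* (5 ℕ.+ j)) ≡ 2 ℕ.* (16 ℕ.+ 2 ℕ.* j)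
  p = solve-∀

-- Choice of the parameters

-- suc t letters serve as block ends and M codes of length k fill the blocks,
-- each of which has length 6 + 2k.
record Parameters (n σ : ℕ) : Set where
  field
    k t M           : ℕ
    σ^k≤n           : σ ^ k ≤ n
    enough-letters  : suc t ≤ σ
    enough-codes    : M ≤ σ ^ k
    blocks-fit      : M ℕ.* suc t ℕ.* (6 ℕ.+ 2 ℕ.* k) ≤ n
    nσ≤384MAWs      : n ℕ.* σ ≤ 384 ℕ.* (M ℕ.* (suc t ℕ.* t)) ℕ.* k

-- All σ letters are used, and `M` counts how many full sets of σ blocks fit. Since `M` is at least
-- 1, rounding it down costs at most a factor 2.
all-letters : ∀ {n t k} → let σ = suc (suc t); B = 6 ℕ.+ 2 ℕ.* suc k in
  σ ^ suc k ≤ n → n < σ ^ suc (suc k) → σ ℕ.* B ≤ n → Parameters n σ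
all-letters {n} {t} {k} lo hi σB≤n = record
  { k = suc k ; t = suc t ; M = M
  ; σ^k≤n = lo
  ; enough-letters = ≤-refl
  -- The maximality of the exponent enters here: σM ≤ n < σ^(k+2), and one factor σ cancels.
  ; enough-codes = <⇒≤ (*-cancelˡ-< σ M (σ ^ suc k) (begin-strict
      σ ℕ.* M ≤⟨ m≤m*n (σ ℕ.* M) B ⟩
      σ ℕ.* M ℕ.* B ≡⟨ p₀ σ M B ⟩
      M ℕ.* (σ ℕ.* B) ≤⟨ m/n*n≤m n (σ ℕ.* B) ⟩
      n <⟨ hi ⟩
      σ ^ suc (suc k) ∎))
  ; blocks-fit = ≤-trans (≤-reflexive (*-assoc M σ B)) (m/n*n≤m n (σ ℕ.* B))
  ; nσ≤384MAWs = begin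
      n ℕ.* σ ≤⟨ *-monoˡ-≤ σ (<⇒≤ n<[1+M]σB) ⟩
      -- The factor 32 is 2 · 8 · 2, from `suc M ≤ M + M`, `B ≤ 8 * suc k` and `σ ≤ 2 * suc t`. The
      -- weaker 384 is the constant that `one-code` gives.
      suc M ℕ.* (σ ℕ.* B) ℕ.* σ
        ≤⟨ *-mono-≤ (*-mono-≤ (+-monoˡ-≤ M 1≤M) (*-monoʳ-≤ σ (6+2[1+k]≤8[1+k] k))) σ≤2[1+t] ⟩
      (M ℕ.+ M) ℕ.* (σ ℕ.* (8 ℕ.* suc k)) ℕ.* (2 ℕ.* suc t) ≡⟨ p₁ M t k ⟩
      32 ℕ.* (M ℕ.* (σ ℕ.* suc t) ℕ.* suc k) ≤⟨ *-monoˡ-≤ (M ℕ.* (σ ℕ.* suc t) ℕ.* suc k) (m≤m+n 32 352) ⟩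
      384 ℕ.* (M ℕ.* (σ ℕ.* suc t) ℕ.* suc k) ≡⟨ *-assoc 384 (M ℕ.* (σ ℕ.* suc t)) (suc k) ⟨
      384 ℕ.* (M ℕ.* (σ ℕ.* suc t)) ℕ.* suc k ∎
  }
  where
  open ≤-Reasoning
  σ = suc (suc t)
  B = 6 ℕ.+ 2 ℕ.* suc k
  M = n / (σ ℕ.* B)
  n<[1+M]σB : n < suc M ℕ.* (σ ℕ.* B)
  n<[1+M]σB = n<[1+n/d]*d n (σ ℕ.* B)
  1≤M : 1 ≤ M
  1≤M = ≤-pred (*-cancelʳ-< (σ ℕ.* B) 1 (suc M)
    (≤-<-trans (≤-trans (≤-reflexive (*-identityˡ (σ ℕ.* B))) σB≤n) n<[1+M]σB))
  σ≤2[1+t] : σ ≤ 2 ℕ.* suc t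
  σ≤2[1+t] = ≤-trans (m≤m+n σ t) (≤-reflexive (q t))
    where
    q : ∀ t → suc (suc t) ℕ.+ t ≡ 2 ℕ.* suc t
    q = solve-∀
  p₀ : ∀ a b c → a ℕ.* b ℕ.* c ≡ b ℕ.* (a ℕ.* c)
  p₀ = solve-∀
  p₁ : ∀ M t k → (M ℕ.+ M) ℕ.* (suc (suc t) ℕ.* (8 ℕ.* suc k)) ℕ.* (2 ℕ.* suc t) ≡
                 32 ℕ.* (M ℕ.* (suc (suc t) ℕ.* suc t) ℕ.* suc k)
  p₁ = solve-∀

-- Here n is too small for a block of each letter, so one code is used, with
-- as many letters as fit.
one-code : ∀ {n σ k} → let B = 6 ℕ.+ 2 ℕ.* suc k in
  32 ≤ n → 2 ≤ σ → σ ^ suc k ≤ n → n < σ ℕ.* B → Parameters n σ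
one-code {n} {σ} {k} 32≤n 2≤σ lo n<σB with n / (6 ℕ.+ 2 ℕ.* suc k) in eq
... | s = go s 2≤s s<σ sB≤n n<[1+s]B
  where
  open ≤-Reasoning
  B = 6 ℕ.+ 2 ℕ.* suc k
  sB≤n : s ℕ.* B ≤ n
  sB≤n = subst (λ s → s ℕ.* B ≤ n) eq (m/n*n≤m n B)
  n<[1+s]B : n < suc s ℕ.* B
  n<[1+s]B = subst (λ s → n < suc s ℕ.* B) eq (n<[1+n/d]*d n B)
  s<σ : s < σ
  s<σ = *-cancelʳ-< B s σ (≤-<-trans sB≤n n<σB)
  2≤s : 2 ≤ s
  2≤s = ≤-pred (*-cancelʳ-< B 2 (suc s)
    (≤-<-trans (two-blocks-fit (suc k) 32≤n (≤-trans (^-monoˡ-≤ (suc k) 2≤σ) lo)) n<[1+s]B))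
  B≤8*2^k : B ≤ 8 ℕ.* 2 ^ k
  B≤8*2^k = ≤-trans (≤-reflexive (q k)) (8+2k≤8*2^k k)
    where
    q : ∀ k → 6 ℕ.+ 2 ℕ.* suc k ≡ 8 ℕ.+ 2 ℕ.* k
    q = solve-∀
  go : ∀ s → 2 ≤ s → s < σ → s ℕ.* B ≤ n → n < suc s ℕ.* B → Parameters n σ
  go 1 (s≤s ()) _ _ _
  go s@(suc (suc t)) _ s<σ sB≤n n<[1+s]B = record
    { k = suc k ; t = suc t ; M = 1
    ; σ^k≤n = lo
    ; enough-letters = <⇒≤ s<σ
    ; enough-codes = ≤-trans (≤-reflexive (sym (^-zeroˡ (suc k)))) (^-monoˡ-≤ (suc k) (≤-trans (s≤s z≤n) 2≤σ))
    ; blocks-fit = ≤-trans (≤-reflexive (cong (ℕ._* B) (*-identityˡ s))) sB≤n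
    ; nσ≤384MAWs = begin
        n ℕ.* σ ≤⟨ *-mono-≤ (<⇒≤ n<[1+s]B) σ≤24[1+t] ⟩
        suc s ℕ.* B ℕ.* (24 ℕ.* suc t)
          -- `suc s + suc t` is twice `s`, so the constant is 2 · 8 · 24 = 384.
          ≤⟨ *-monoˡ-≤ (24 ℕ.* suc t) (*-mono-≤ (m≤m+n (suc s) (suc t)) (6+2[1+k]≤8[1+k] k)) ⟩
        (suc s ℕ.+ suc t) ℕ.* (8 ℕ.* suc k) ℕ.* (24 ℕ.* suc t) ≡⟨ p₁ t k ⟩
        384 ℕ.* (1 ℕ.* (s ℕ.* suc t)) ℕ.* suc k ∎
    }
    where
    p₁ : ∀ t k → (suc (suc (suc t)) ℕ.+ suc t) ℕ.* (8 ℕ.* suc k) ℕ.* (24 ℕ.* suc t) ≡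
                 384 ℕ.* (1 ℕ.* (suc (suc t) ℕ.* suc t)) ℕ.* suc k
    p₁ = solve-∀
    1+s≤3[1+t] : suc s ≤ 3 ℕ.* suc t
    1+s≤3[1+t] = ≤-trans (m≤m+n (suc s) (2 ℕ.* t)) (≤-reflexive (q t))
      where
      q : ∀ t → suc (suc (suc t)) ℕ.+ 2 ℕ.* t ≡ 3 ℕ.* suc t
      q = solve-∀
    -- The letters used are a constant fraction of all σ: from σ · 2^k ≤ σ^(k+1) ≤ n < (s + 1)B and
    -- B ≤ 8 · 2^k follows σ ≤ 8(s + 1), and s + 1 ≤ 3(s - 1) because s ≥ 2.
    σ≤24[1+t] : σ ≤ 24 ℕ.* suc t
    σ≤24[1+t] = *-cancelʳ-≤ σ (24 ℕ.* suc t) (2 ^ k) {{m^n≢0 2 k}} (begin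
      σ ℕ.* 2 ^ k ≤⟨ *-monoʳ-≤ σ (^-monoˡ-≤ k 2≤σ) ⟩
      σ ^ suc k ≤⟨ lo ⟩
      n ≤⟨ <⇒≤ n<[1+s]B ⟩
      suc s ℕ.* B ≤⟨ *-mono-≤ 1+s≤3[1+t] B≤8*2^k ⟩
      3 ℕ.* suc t ℕ.* (8 ℕ.* 2 ^ k) ≡⟨ p₂ t (2 ^ k) ⟩
      24 ℕ.* suc t ℕ.* 2 ^ k ∎)
      where
      p₂ : ∀ t m → 3 ℕ.* suc t ℕ.* (8 ℕ.* m) ≡ 24 ℕ.* suc t ℕ.* m
      p₂ = solve-∀

parameters : ∀ {n σ} → 32 ≤ n → 2 ≤ σ → σ ≤ n → Parameters n σ
parameters {σ = 1} _ (s≤s ()) _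
parameters {n} {σ@(suc (suc t))} 32≤n 2≤σ σ≤n with ⌊log⌋ 2≤σ n (≤-trans (s≤s z≤n) 32≤n)
-- Exponent 0 would mean n < σ. Hence codes have positive length, as the bound of a block length by
-- 8 times the code length requires.
... | zero , lo , hi = ⊥-elim (<⇒≱ hi (≤-trans (≤-reflexive (*-identityʳ σ)) σ≤n))
... | suc k , lo , hi with σ ℕ.* (6 ℕ.+ 2 ℕ.* suc k) ≤? n
...   | yes fits = all-letters lo hi fits
...   | no ¬fits = one-code 32≤n 2≤σ lo (≰⇒> ¬fits)

-- Passage to the real logarithm

^-cancelʳ-< : ∀ {σ} → 2 ≤ σ → ∀ {i j} → σ ^ i < σ ^ j → i < j
^-cancelʳ-< {suc σ} 2≤σ {i} {j} lt = ≰⇒> (λ j≤i → <⇒≱ lt (^-monoʳ-≤ (suc σ) j≤i))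

-- `mkℚᵘ` takes the denominator minus one, so this is 1/384.
c₀ : ℚᵘ
c₀ = mkℚᵘ (+ 1) 383

-- Any q = S / T above the logarithm exceeds k: σ^(kT) ≤ n^T < σ^S gives kT < S. Dividing by q
-- therefore yields at most the quotient by k, which `bound` controls.
log-bound : ∀ {n σ k V} → 2 ≤ σ → σ ^ k ≤ n → n ℕ.* σ ≤ 384 ℕ.* V ℕ.* k →
  (c₀ * fromℕ n * fromℕ σ) /log[ σ ] n ≤ fromℕ V
log-bound 2≤σ σ^k≤n bound (mkℚᵘ (+ 0) d) {{()}}
log-bound 2≤σ σ^k≤n bound (mkℚᵘ -[1+ _ ] d) {{()}}
log-bound {n} {σ} {k} {V} 2≤σ σ^k≤n bound (mkℚᵘ +[1+ p ] d) n^T<σ^S = *≤* (begin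
  + 1 ℤ.* + n ℤ.* + σ ℤ.* + T ℤ.* + 1 ≡⟨ ℤ.*-identityʳ _ ⟩
  + 1 ℤ.* + n ℤ.* + σ ℤ.* + T ≡⟨ cong (λ i → i ℤ.* + σ ℤ.* + T) (ℤ.*-identityˡ (+ n)) ⟩
  + n ℤ.* + σ ℤ.* + T ≡⟨ cong (ℤ._* + T) (ℤ.pos-* n σ) ⟨
  + (n ℕ.* σ) ℤ.* + T ≡⟨ ℤ.pos-* (n ℕ.* σ) T ⟨
  + (n ℕ.* σ ℕ.* T) ≤⟨ +≤+ nσT≤384VS ⟩
  + (V ℕ.* (384 ℕ.* S)) ≡⟨ ℤ.pos-* V (384 ℕ.* S) ⟩
  + V ℤ.* + (384 ℕ.* S) ∎)
  where
  open ℤ.≤-Reasoning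
  S = suc p
  T = suc d
  kT<S : k ℕ.* T < S
  kT<S = ^-cancelʳ-< 2≤σ
    (≤-<-trans (≤-trans (≤-reflexive (sym (^-*-assoc σ k T))) (^-monoˡ-≤ T σ^k≤n)) n^T<σ^S)
  nσT≤384VS : n ℕ.* σ ℕ.* T ≤ V ℕ.* (384 ℕ.* S)
  nσT≤384VS = ≤-trans (*-monoˡ-≤ T bound)
    (≤-trans (≤-reflexive (*-assoc (384 ℕ.* V) k T))
      (≤-trans (*-monoʳ-≤ (384 ℕ.* V) (<⇒≤ kT<S)) (≤-reflexive (q V S))))
    where
    q : ∀ V S → 384 ℕ.* V ℕ.* S ≡ V ℕ.* (384 ℕ.* S)
    q = solve-∀

-- Assembly of the word from letters, codes and padding

theorem2 : Σ[ c ∈ ℚᵘ ] Positive c × (Σ[ n₀ ∈ ℕ ]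
    ((n σ : ℕ) → n₀ ≤ n → 2 ≤ σ → σ ≤ n →
    Σ[ w ∈ List (Fin σ) ] (length w ≡ n) × (Σ[ m ∈ ℕ ]
    (Σ[ vs ∈ List (List (Fin σ)) ]
    Unique vs
    × All (λ v → IsMinimalAbsentWord w v × length v ≡ m) vs
    × ((c * fromℕ n * fromℕ σ) /log[ σ ] n ≤ fromℕ (length vs))))))
theorem2 = c₀ , _ , 32 , construct
  where
  construct : ∀ n σ → 32 ≤ n → 2 ≤ σ → σ ≤ n → _
  construct _ 1 _ (s≤s ()) _
  construct n σ@(suc (suc _)) 32≤n 2≤σ σ≤n =
    word bs r ,
    trans (length-word bs r) (trans
      (cong (λ l → l ℕ.* (6 ℕ.+ 2 ℕ.* k) ℕ.+ r) (length-blocks letter letter-inj code code-inj))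
      (m+[n∸m]≡n blocks-fit)) ,
    -- The common length `4 + (2 * k + 1)`, inferred from `absentWords-minimal`.
    _ ,
    absentWords letter letter-inj code code-inj ,
    absentWords-unique letter letter-inj code code-inj ,
    absentWords-minimal letter letter-inj code code-inj r ,
    log-bound 2≤σ σ^k≤n (subst (λ V → n ℕ.* σ ≤ 384 ℕ.* V ℕ.* k)
      (sym (length-absentWords letter letter-inj code code-inj)) nσ≤384MAWs)
    where
    open Parameters (parameters 32≤n 2≤σ σ≤n)
    open Blocks {Fin σ} zero (suc zero) (λ ())
    letter : Fin (suc t) → Fin σ
    letter i = inject≤ i enough-letters
    letter-inj : ∀ {i j} → letter i ≡ letter j → i ≡ j
    letter-inj = inject≤-injective enough-letters enough-letters _ _
    code : Fin M → Vec (Fin σ) k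
    code j = digits (inject≤ j enough-codes)
    code-inj : ∀ {i j} → code i ≡ code j → i ≡ j
    code-inj = inject≤-injective enough-codes enough-codes _ _ ∘ digits-injective {σ} {k}
    bs = blocks letter letter-inj code code-inj
    -- `blocks-fit` makes this truncated subtraction exact, so the padded word has length n.
    r = n ∸ M ℕ.* suc t ℕ.* (6 ℕ.+ 2 ℕ.* k)
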